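{- Let $\Gamma$ be a MaxSAT instance encoded with blocking variables $b_1,\dots,b_m$. If there is a derivation in the cost-SR calculus from $\Gamma$ that contains $k$ unit clauses $b_{i_1},\dots,b_{i_k}$ for $k$ distinct indices $i_1,\dots,i_k$, then $\mathrm{cost}(\Gamma)\ge k$. If moreover the derivation also contains all unit clauses $\lnot b_j$ for $j\notin\{i_1,\dots,i_k\}$, then $\mathrm{cost}(\Gamma)=k$.
   Context: Literals are variables $x$ or negations $\lnot x$; a clause is a disjunction of literals; a CNF is identified with the multiset of its clauses; $\mathrm{Var}(\Gamma)$ is its set of variables. A substitution $\sigma$ maps each variable to $0$, $1$ or a literal, extended by $\sigma(0)=0,\sigma(1)=1,\sigma(\lnot x)=\lnot\sigma(x)$; composition is $(\sigma\circ\tau)(x)=\sigma(\tau(x))$. A (partial) assignment is a substitution with $\sigma(x)\in\{0,1,x\}$ for all $x$; its domain is $\sigma^{ -1}(\{0,1\})$; it is total if it assigns all variables a Boolean value. $C{\upharpoonright}_\sigma$ is the clause obtained by applying $\sigma$ to every literal and simplifying ($D\lor 0=D$, $D\lor 1=1$, repeated literals merged); $\sigma$ satisfies $C$ if $C{\upharpoonright}_\sigma=1$ or is a tautology. $\Gamma{\upharpoonright}_\sigma$ is the multiset of $C{\upharpoonright}_\sigma$ for $C\in\Gamma$ with $C{\upharpoonright}_\sigma\ne 1$. For a clause $C$, $\lnot C$ denotes the partial assignment setting all literals of $C$ to $0$; $\tau\supseteq\rho$ means $\tau$ extends $\rho$. Unit propagation repeatedly picks a unit clause $\ell$, deletes clauses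 containing $\ell$ and removes $\lnot\ell$ from the others, until no unit clause remains. $\Gamma\vdash_1 C$ means unit propagation on $\Gamma{\upharpoonright}_{\lnot C}$ produces the empty clause; $\Gamma\vdash_1\Delta$ means $\Gamma\vdash_1 D$ for all $D\in\Delta$. A MaxSAT instance encoded with blocking variables is a CNF (of hard clauses) $\Gamma=H\cup\{C_1\lor b_1,\dots,C_m\lor b_m\}$ where $b_1,\dots,b_m$ are distinct variables (blocking variables) not occurring in $H,C_1,\dots,C_m$ (the soft clauses $\lnot b_1,\dots,\lnot b_m$ are implicit). For a total assignment $\alpha$, $\mathrm{cost}(\alpha)=\sum_{i=1}^m\alpha(b_i)$, and $\mathrm{cost}(\Gamma)=\min\{\mathrm{cost}(\alpha):\alpha\text{ total},\ \alpha\models\Gamma\}$ (same definition for any CNF containing the designated blocking variables). A clause $C$ is cost-SR w.r.t. $\Gamma$ if there is a substitution $\sigma$ with (1) $\Gamma{\upharpoonright}_{\lnot C}\vdash_1(\Gamma\cup\{C\}){\upharpoonright}_\sigma$ and (2) $\mathrm{cost}(\tau\circ\sigma)\le\mathrm{cost}(\tau)$ for every total assignment $\tau\supseteq\lnot C$. A derivation in the cost-SR calculus from $\Gamma$ is a sequence of clauses $D_1,\dots,D_t$ where each $D_i$ is in $\Gamma$, or follows from earlier clauses of $\Gamma\cup\{D_1,\dots,D_{i-1}\}$ by weakening (from $A$ infer any $B\supseteq A$) or resolution (from $A\lor x$ and $B\lor\lnot x$ infer $A\lor B$), or is cost-SR w.r.t. $\Gamma\cup\{D_1,\dots,D_{i-1}\}$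 with $\mathrm{Var}(D_i)\subseteq\mathrm{Var}(\Gamma)$ (the witnessing substitution is attached).
   Formalization: The equality cost(Γ) = k is stated for satisfiable Γ only; if Γ is unsatisfiable (e.g. H contains the empty clause and m = k = 0), the minimum defining cost(Γ) is over the empty set and the claim fails. The bound cost(Γ) ≥ k needs no such assumption. -}

module Defs where

open import Data.Bool.Base using (Bool; true; false; not; if_then_else_)
open import Data.Fin.Base using (Fin)
open import Data.List.Base
  using (List; []; _∷_; [_]; _++_; map; concatMap; foldr; filter; mapMaybe; tabulate)
open import Data.List.Membership.Propositional using (_∈_; _∉_)
open import Data.List.Relation.Binary.BagAndSetEquality using (_∼[_]_; set)
open import Data.List.Relation.Binary.Subset.Propositional using (_⊆_)
open import Data.List.Relation.Unary.All using (All)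
open import Data.List.Relation.Unary.Any using (Any)
open import Data.Maybe.Base as Maybe using (Maybe; just; nothing)
import Data.Maybe.Relation.Unary.All as MaybeAll
open import Data.Nat.Base using (ℕ; _≤_)
import Data.Nat.Properties as ℕ
open import Algebra.Properties.CommutativeMonoid.Sum ℕ.+-0-commutativeMonoid using (sum)
open import Data.Product.Base using (∃-syntax; _×_)
open import Data.Sum.Base using (_⊎_)
open import Function.Definitions using (Injective)
open import Relation.Binary.Construct.Closure.ReflexiveTransitive using (Star)
open import Relation.Binary.Definitions using (DecidableEquality)
open import Relation.Binary.PropositionalEquality using (_≡_; refl; cong)
open import Relation.Nullary using (yes; no; does)
open import Relation.Nullary.Decidable using (map′; ¬?)

------------------------------------------------------------------------
-- Clauses and CNFs

Var : Set
Var = ℕ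

data Literal : Set where
  pos neg : Var → Literal

infix 8 ~_

~_ : Literal → Literal
~ pos x = neg x
~ neg x = pos x

var : Literal → Var
var (pos x) = x
var (neg x) = x

infix 4 _≟ˡ_

_≟ˡ_ : DecidableEquality Literal
pos x ≟ˡ pos y = map′ (cong pos) (λ { refl → refl }) (x ℕ.≟ y)
pos x ≟ˡ neg y = no λ ()
neg x ≟ˡ pos y = no λ ()
neg x ≟ˡ neg y = map′ (cong neg) (λ { refl → refl }) (x ℕ.≟ y)

open import Data.List.Membership.DecPropositional _≟ˡ_ using (_∈?_)

-- A clause is the disjunction of the literals in the list.  Order and
-- repetitions are immaterial: clauses are compared by _≈_, never by _≡_.
Clause : Set
Clause = List Literal

infix 4 _≈_ _∈ᶜ_

_≈_ : Clause → Clause → Set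
C ≈ D = C ∼[ set ] D

-- As a multiset of clauses; the order is immaterial.
CNF : Set
CNF = List Clause

_∈ᶜ_ : Clause → CNF → Set
C ∈ᶜ Γ = Any (C ≈_) Γ

Tautology : Clause → Set
Tautology C = ∃[ x ] pos x ∈ C × neg x ∈ C

varsᶜ : Clause → List Var
varsᶜ = map var

vars : CNF → List Var
vars = concatMap varsᶜ

------------------------------------------------------------------------
-- Substitutions and assignments

data Value : Set where
  const : Bool → Value
  lit   : Literal → Value

¬ᵛ_ : Value → Value
¬ᵛ const v = const (not v)
¬ᵛ lit ℓ   = lit (~ ℓ)

Substitution : Set
Substitution = Var → Value

applyˡ : Substitution → Literal → Value
applyˡ σ (pos x) = σ x
applyˡ σ (neg x) = ¬ᵛ σ x

applyᵛ : Substitution → Value → Value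
applyᵛ σ (const v) = const v
applyᵛ σ (lit ℓ)   = applyˡ σ ℓ

infixr 9 _∘ˢ_

_∘ˢ_ : Substitution → Substitution → Substitution
(σ ∘ˢ τ) x = applyᵛ σ (τ x)

Total : Substitution → Set
Total α = ∀ x → ∃[ v ] α x ≡ const v

infix 4 _⊇ˢ_

-- Extension of partial assignments.
_⊇ˢ_ : Substitution → Substitution → Set
τ ⊇ˢ ρ = ∀ x v → ρ x ≡ const v → τ x ≡ const v

-- The partial assignment setting every literal of C to 0.  It does so only
-- if C is not a tautology; for tautological C it is immaterial below.
¬ᶜ_ : Clause → Substitution
(¬ᶜ C) x = if does (pos x ∈? C) then const false
           else if does (neg x ∈? C) then const true
           else lit (pos x)

infixr 5 _∨ᵛ_
infixl 6 _↾ᶜ_ _↾_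

-- In Maybe Clause, nothing is the constant 1; the constant 0 is the empty
-- clause.
_∨ᵛ_ : Value → Maybe Clause → Maybe Clause
const true  ∨ᵛ D = nothing
const false ∨ᵛ D = D
lit ℓ       ∨ᵛ D = Maybe.map (λ E → if does (ℓ ∈? E) then E else ℓ ∷ E) D

_↾ᶜ_ : Clause → Substitution → Maybe Clause
C ↾ᶜ σ = foldr (λ ℓ D → applyˡ σ ℓ ∨ᵛ D) (just []) C

_↾_ : CNF → Substitution → CNF
Γ ↾ σ = mapMaybe (_↾ᶜ σ) Γ

infix 4 _⊨ᶜ_ _⊨_

-- C ↾ᶜ σ is 1 or a tautology.
_⊨ᶜ_ : Substitution → Clause → Set
σ ⊨ᶜ C = MaybeAll.All Tautology (C ↾ᶜ σ)

_⊨_ : Substitution → CNF → Set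
σ ⊨ Γ = All (σ ⊨ᶜ_) Γ

------------------------------------------------------------------------
-- Unit propagation

propagate : Literal → CNF → CNF
propagate ℓ Γ = map (filter (λ ℓ′ → ¬? (ℓ′ ≟ˡ ~ ℓ))) (filter (λ C → ¬? (ℓ ∈? C)) Γ)

infix 4 _⟶_ _⊢₁_ _⊢₁*_

-- Matching on [ ℓ ] finds all unit clauses, since propagation only starts
-- from restricted CNFs, whose clauses have no repeated literals.
data _⟶_ (Γ : CNF) : CNF → Set where
  unit : ∀ {ℓ} → [ ℓ ] ∈ Γ → Γ ⟶ propagate ℓ Γ

UPRefutes : CNF → Set
UPRefutes Γ = ∃[ Δ ] Star _⟶_ Γ Δ × (∀ ℓ → [ ℓ ] ∉ Δ) × [] ∈ Δ

-- If C is a tautology then no assignment sets all its literals to 0, and C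
-- is implied by every CNF.
_⊢₁_ : CNF → Clause → Set
Γ ⊢₁ C = Tautology C ⊎ UPRefutes (Γ ↾ (¬ᶜ C))

_⊢₁*_ : CNF → CNF → Set
Γ ⊢₁* Δ = All (Γ ⊢₁_) Δ

------------------------------------------------------------------------
-- MaxSAT instances and cost

record MaxSAT (m : ℕ) : Set where
  field
    hard            : CNF
    soft            : Fin m → Clause
    block           : Fin m → Var
    block-injective : Injective _≡_ _≡_ block
    block∉hard      : ∀ i → block i ∉ vars hard
    block∉soft      : ∀ i j → block i ∉ varsᶜ (soft j)

  cnf : CNF
  cnf = hard ++ tabulate (λ i → pos (block i) ∷ soft i)

module _ {m : ℕ} (b : Fin m → Var) where

  -- Only meaningful for total α, where no value is a literal.
  cost : Substitution → ℕ
  cost α = sum (λ i → bit (α (b i)))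
    where
    bit : Value → ℕ
    bit (const true)  = 1
    bit (const false) = 0
    bit (lit _)       = 0

  -- cost(Γ) ≥ k and cost(Γ) = k, where cost(Γ) is the minimum cost of a total
  -- assignment satisfying Γ, or ∞ if there is none.
  CostAtLeast : CNF → ℕ → Set
  CostAtLeast Γ k = ∀ α → Total α → α ⊨ Γ → k ≤ cost α

  CostIs : CNF → ℕ → Set
  CostIs Γ k = (∃[ α ] Total α × α ⊨ Γ × cost α ≡ k) × CostAtLeast Γ k

Satisfiable : CNF → Set
Satisfiable Γ = ∃[ α ] Total α × α ⊨ Γ

------------------------------------------------------------------------
-- The cost-SR calculus

module _ {m : ℕ} (b : Fin m → Var) where

  -- For tautological C, both conditions concern the inconsistent ¬ C and
  -- are taken to hold, as in _⊢₁_; such a C is satisfied by every total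
  -- assignment anyway.
  CostSR : CNF → Clause → Set
  CostSR Γ C = Tautology C ⊎
    (∃[ σ ] (Γ ↾ (¬ᶜ C) ⊢₁* (C ∷ Γ) ↾ σ)
          × (∀ τ → Total τ → τ ⊇ˢ ¬ᶜ C → cost b (τ ∘ˢ σ) ≤ cost b τ))

  -- Step Γ Ds D: D can be added to a derivation from Γ consisting of Ds.
  data Step (Γ Ds : CNF) (D : Clause) : Set where
    axiom   : D ∈ᶜ Γ → Step Γ Ds D
    weaken  : ∀ {A} → A ∈ᶜ Ds ++ Γ → A ⊆ D → Step Γ Ds D
    resolve : ∀ {A B} x → (pos x ∷ A) ∈ᶜ Ds ++ Γ → (neg x ∷ B) ∈ᶜ Ds ++ Γ →
              D ≈ A ++ B → Step Γ Ds D
    cost-sr : CostSR (Ds ++ Γ) D → varsᶜ D ⊆ vars Γ → Step Γ Ds D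

  infixl 5 _▷_

  -- The clauses of the derivation are listed last one first.
  data Derivation (Γ : CNF) : CNF → Set where
    ∅   : Derivation Γ []
    _▷_ : ∀ {Ds D} → Derivation Γ Ds → Step Γ Ds D → Derivation Γ (D ∷ Ds)

{-# OPTIONS --safe #-}
-- Every total model α of Γ can be moved, without raising its cost, to a model
-- of Γ and the whole derivation: at a cost-SR step deriving D, if α falsifies D
-- then α extends ¬ D, so α satisfies everything that unit propagation derives
-- from the restricted CNF, hence α ∘ σ satisfies the old clauses and D.  The
-- resulting model sets every derived b_i to 1 and every derived ¬ b_j to 0,
-- which determines its cost.
module Submission where

open import Defs
open import Data.Bool.Base using (true; false; not)
open import Data.Bool.Properties using (not-involutive)
open import Data.Fin.Base using (Fin; zero; suc; punchIn; punchOut)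
open import Data.Fin.Properties
  using (punchIn-injective; punchInᵢ≢i; punchIn-punchOut; punchOut-injective; suc-injective)
open import Data.List.Base using ([]; _∷_; [_]; _++_; filter; map; mapMaybe)
open import Data.List.Membership.DecPropositional _≟ˡ_ using (_∈?_)
open import Data.List.Membership.Propositional using (lose)
open import Data.List.Relation.Binary.Subset.Propositional.Properties
  using (Any-resp-⊆)
open import Data.List.Relation.Unary.All as All using (All; []; _∷_)
import Data.List.Relation.Unary.All.Properties as All
open import Data.List.Relation.Unary.Any as Any using (Any; here; there; any?)
import Data.List.Relation.Unary.Any.Properties as Any
open import Data.Maybe.Base using (Maybe; just; nothing)
import Data.Maybe.Relation.Unary.All as MaybeAll
open import Data.Nat.Base using (ℕ; zero; suc; _+_; _≤_)
import Data.Nat.Properties as ℕ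
open import Algebra.Properties.CommutativeMonoid.Sum ℕ.+-0-commutativeMonoid
  using (sum; sum-remove; sum-cong-≗)
open import Data.Product.Base using (∃-syntax; _×_; _,_; proj₁; proj₂)
open import Data.Sum.Base using (_⊎_; inj₁; inj₂)
open import Function.Base using (_∘_)
open import Function.Bundles using (Equivalence)
open import Function.Definitions using (Injective)
open import Relation.Binary.Construct.Closure.ReflexiveTransitive using (Star; ε; _◅_)
open import Relation.Binary.PropositionalEquality
  using (_≡_; _≢_; _≗_; refl; sym; trans; cong; cong₂; subst; module ≡-Reasoning)
open import Relation.Nullary using (¬_; Dec; yes; no; contradiction)
open import Relation.Nullary.Decidable using (¬?)

-- Total models

¬ᵛ-involutive : ∀ v → ¬ᵛ ¬ᵛ v ≡ v
¬ᵛ-involutive (const v)     = cong const (not-involutive v)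
¬ᵛ-involutive (lit (pos _)) = refl
¬ᵛ-involutive (lit (neg _)) = refl

applyˡ-~ : ∀ α ℓ → applyˡ α (~ ℓ) ≡ ¬ᵛ applyˡ α ℓ
applyˡ-~ α (pos x) = refl
applyˡ-~ α (neg x) = sym (¬ᵛ-involutive (α x))

applyᵛ-¬ᵛ : ∀ α v → applyᵛ α (¬ᵛ v) ≡ ¬ᵛ applyᵛ α v
applyᵛ-¬ᵛ α (const _) = refl
applyᵛ-¬ᵛ α (lit ℓ)   = applyˡ-~ α ℓ

applyˡ-∘ˢ : ∀ α σ ℓ → applyˡ (α ∘ˢ σ) ℓ ≡ applyᵛ α (applyˡ σ ℓ)
applyˡ-∘ˢ α σ (pos x) = refl
applyˡ-∘ˢ α σ (neg x) = sym (applyᵛ-¬ᵛ α (σ x))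

applyˡ-cong : ∀ {α β} → α ≗ β → applyˡ α ≗ applyˡ β
applyˡ-cong α≗β (pos x) = α≗β x
applyˡ-cong α≗β (neg x) = cong ¬ᵛ_ (α≗β x)

Total-applyˡ : ∀ {α} → Total α → ∀ ℓ → ∃[ v ] applyˡ α ℓ ≡ const v
Total-applyˡ α-total (pos x) = α-total x
Total-applyˡ α-total (neg x) with v , eq ← α-total x = not v , cong ¬ᵛ_ eq

Total-∘ˢ : ∀ {α} σ → Total α → Total (α ∘ˢ σ)
Total-∘ˢ σ α-total x with σ x
... | const v = v , refl
... | lit ℓ   = Total-applyˡ α-total ℓ

True : Substitution → Literal → Set
True α ℓ = applyˡ α ℓ ≡ const true

-- On total assignments this agrees with _⊨ᶜ_, and it is the easier form to
-- compose with substitutions.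
Sat : Substitution → Clause → Set
Sat α = Any (True α)

True⇒¬True-~ : ∀ α ℓ → True α ℓ → ¬ True α (~ ℓ)
True⇒¬True-~ α ℓ t t′
  with () ← trans (sym t′) (trans (applyˡ-~ α ℓ) (cong ¬ᵛ_ t))

sat? : ∀ {α} → Total α → ∀ C → Dec (Sat α C)
sat? {α} α-total = any? true?
  where
  true? : ∀ ℓ → Dec (True α ℓ)
  true? ℓ with Total-applyˡ α-total ℓ
  ... | true  , eq = yes eq
  ... | false , eq = no λ t → contradiction (trans (sym eq) t) λ ()

Sat-cong : ∀ {α β} → α ≗ β → ∀ {C} → Sat α C → Sat β C
Sat-cong α≗β = Any.map λ {ℓ} → trans (sym (applyˡ-cong α≗β ℓ))

Tautology⇒Sat : ∀ {α C} → Total α → Tautology C → Sat α C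
Tautology⇒Sat α-total (x , x∈C , ¬x∈C) with α-total x
... | true  , eq = lose x∈C eq
... | false , eq = lose ¬x∈C (cong ¬ᵛ_ eq)

Sat-∈ᶜ : ∀ {α C Γ} → C ∈ᶜ Γ → All (Sat α) Γ → Sat α C
Sat-∈ᶜ C∈Γ α⊨Γ with α⊨D , C≈D ← All.lookupAny α⊨Γ C∈Γ =
  Any-resp-⊆ (Equivalence.from C≈D) α⊨D

-- Restriction

-- `nothing` is the constant 1 and `MaybeAll.All` holds of it vacuously, so `MaybeAll.All (Sat α)`
-- is satisfaction extended to restricted clauses.
∨ᵛ⁺ : ∀ {α} v {D} → applyᵛ α v ≡ const true ⊎ MaybeAll.All (Sat α) D →
      MaybeAll.All (Sat α) (v ∨ᵛ D)
∨ᵛ⁺ (const true)  _        = MaybeAll.nothing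
∨ᵛ⁺ (const false) (inj₂ p) = p
∨ᵛ⁺ (lit ℓ) {nothing} _    = MaybeAll.nothing
∨ᵛ⁺ (lit ℓ) {just E} p with ℓ ∈? E | p
-- The literal is merged into `E`, so its truth is witnessed at the occurrence already there.
... | yes ℓ∈E | inj₁ t                 = MaybeAll.just (lose ℓ∈E t)
... | yes _   | inj₂ α⊨E               = α⊨E
... | no _    | inj₁ t                 = MaybeAll.just (here t)
... | no _    | inj₂ (MaybeAll.just s) = MaybeAll.just (there s)

∨ᵛ⁻ : ∀ {α} v {D} → MaybeAll.All (Sat α) (v ∨ᵛ D) →
      applyᵛ α v ≡ const true ⊎ MaybeAll.All (Sat α) D
∨ᵛ⁻ (const true)  _     = inj₁ refl
∨ᵛ⁻ (const false) p     = inj₂ p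
∨ᵛ⁻ (lit ℓ) {nothing} _ = inj₂ MaybeAll.nothing
∨ᵛ⁻ (lit ℓ) {just E} p with ℓ ∈? E | p
... | yes _ | α⊨E                     = inj₂ α⊨E
... | no _  | MaybeAll.just (here t)  = inj₁ t
... | no _  | MaybeAll.just (there s) = inj₂ (MaybeAll.just s)

-- With `↾ᶜ⁻`, this is the substitution lemma: restricting by `σ` and then evaluating under `α`
-- amounts to evaluating under `α ∘ˢ σ`.
↾ᶜ⁺ : ∀ {α σ} C → Sat (α ∘ˢ σ) C → MaybeAll.All (Sat α) (C ↾ᶜ σ)
↾ᶜ⁺ {α} {σ} (ℓ ∷ C) (here t)  = ∨ᵛ⁺ (applyˡ σ ℓ) (inj₁ (trans (sym (applyˡ-∘ˢ α σ ℓ)) t))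
↾ᶜ⁺ {α} {σ} (ℓ ∷ C) (there s) = ∨ᵛ⁺ (applyˡ σ ℓ) (inj₂ (↾ᶜ⁺ C s))

↾ᶜ⁻ : ∀ {α σ} C → MaybeAll.All (Sat α) (C ↾ᶜ σ) → Sat (α ∘ˢ σ) C
↾ᶜ⁻ [] (MaybeAll.just ())
↾ᶜ⁻ {α} {σ} (ℓ ∷ C) p with ∨ᵛ⁻ (applyˡ σ ℓ) p
... | inj₁ t = here (trans (applyˡ-∘ˢ α σ ℓ) t)
... | inj₂ q = there (↾ᶜ⁻ C q)

-- A dropped element has image `nothing`, where the conclusion is vacuous.
mapMaybe⁻ : ∀ {A B : Set} {P : B → Set} (f : A → Maybe B) xs →
            All P (mapMaybe f xs) → All (MaybeAll.All P) (map f xs)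
mapMaybe⁻ f []       _ = []
mapMaybe⁻ f (x ∷ xs) p with f x | p
... | nothing | ps     = MaybeAll.nothing ∷ mapMaybe⁻ f xs ps
... | just _  | q ∷ qs = MaybeAll.just q ∷ mapMaybe⁻ f xs qs

↾⁺ : ∀ {α σ Γ} → All (Sat (α ∘ˢ σ)) Γ → All (Sat α) (Γ ↾ σ)
↾⁺ = All.mapMaybe⁺ ∘ All.map⁺ ∘ All.map (↾ᶜ⁺ _)

↾⁻ : ∀ {α σ Γ} → All (Sat α) (Γ ↾ σ) → All (Sat (α ∘ˢ σ)) Γ
↾⁻ {σ = σ} {Γ} = All.map (↾ᶜ⁻ _) ∘ All.map⁻ ∘ mapMaybe⁻ (_↾ᶜ σ) Γ

-- Since `α ⊨ᶜ C` restricts by `α` itself, this allows the substitution lemma to be applied with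
-- `σ = α`.
Total-∘ˢ-self : ∀ {α} → Total α → α ∘ˢ α ≗ α
Total-∘ˢ-self {α} α-total x with v , eq ← α-total x =
  trans (cong (applyᵛ α) eq) (sym eq)

⊨ᶜ⇒Sat : ∀ {α} → Total α → ∀ {C} → α ⊨ᶜ C → Sat α C
⊨ᶜ⇒Sat α-total {C} =
  Sat-cong (Total-∘ˢ-self α-total) ∘ ↾ᶜ⁻ C ∘ MaybeAll.map (Tautology⇒Sat α-total)

Sat⇒⊨ᶜ : ∀ {α} → Total α → ∀ {C} → Sat α C → α ⊨ᶜ C
Sat⇒⊨ᶜ α-total (here t) rewrite t = MaybeAll.nothing
Sat⇒⊨ᶜ α-total {ℓ ∷ C} (there s) with Total-applyˡ α-total ℓ
... | true  , eq rewrite eq = MaybeAll.nothing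
... | false , eq rewrite eq = Sat⇒⊨ᶜ α-total s

-- A true literal would satisfy `C`, so all its literals are false. A tautological `C` is excluded
-- by `α⊭C`, so the precedence of positive occurrences in `¬ᶜ C` is harmless.
¬Sat⇒⊇ˢ : ∀ {α} → Total α → ∀ {C} → ¬ Sat α C → α ⊇ˢ ¬ᶜ C
¬Sat⇒⊇ˢ α-total {C} α⊭C x v eq with pos x ∈? C
¬Sat⇒⊇ˢ α-total {C} α⊭C x .false refl | yes x∈C with α-total x
... | true  , αx = contradiction (lose x∈C αx) α⊭C
... | false , αx = αx
¬Sat⇒⊇ˢ α-total {C} α⊭C x v eq | no _ with neg x ∈? C
¬Sat⇒⊇ˢ α-total {C} α⊭C x .true refl | no _ | yes ¬x∈C with α-total x
... | true  , αx = αx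
... | false , αx = contradiction (lose ¬x∈C (cong ¬ᵛ_ αx)) α⊭C

-- On the variables of `C` this is the extension hypothesis; elsewhere `¬ᶜ C` is the identity.
∘ˢ-¬ᶜ : ∀ {α} C → α ⊇ˢ ¬ᶜ C → α ≗ α ∘ˢ ¬ᶜ C
∘ˢ-¬ᶜ C α⊇¬C x with pos x ∈? C | α⊇¬C x
... | yes _ | ext = ext _ refl
... | no _  | ext with neg x ∈? C
...   | yes _ = ext _ refl
...   | no _  = refl

↾¬ᶜ⁺ : ∀ {α C Γ} → α ⊇ˢ ¬ᶜ C → All (Sat α) Γ → All (Sat α) (Γ ↾ ¬ᶜ C)
↾¬ᶜ⁺ {C = C} α⊇¬C = ↾⁺ ∘ All.map (Sat-cong (∘ˢ-¬ᶜ C α⊇¬C))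

-- Unit propagation

propagate-sound : ∀ {α ℓ Γ} → True α ℓ → All (Sat α) Γ → All (Sat α) (propagate ℓ Γ)
propagate-sound {α} {ℓ} t =
  All.map⁺ ∘ All.map Sat-filter ∘ All.filter⁺ (λ C → ¬? (ℓ ∈? C))
  where
  Sat-filter : ∀ {C} → Sat α C → Sat α (filter (λ ℓ′ → ¬? (ℓ′ ≟ˡ ~ ℓ)) C)
  Sat-filter s with Any.filter⁺ (λ ℓ′ → ¬? (ℓ′ ≟ˡ ~ ℓ)) s
  ... | inj₁ s′ = s′
  -- The literal witnessing satisfaction was filtered out, so it could only be `~ ℓ`, which is false
  -- under `α`.
  ... | inj₂ ¬≢ = contradiction
    (λ eq → True⇒¬True-~ α ℓ t (subst (True α) eq (Any.lookup-result s))) ¬≢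

⟶*-sound : ∀ {α Γ Δ} → Star _⟶_ Γ Δ → All (Sat α) Γ → All (Sat α) Δ
⟶*-sound ε               α⊨Γ = α⊨Γ
⟶*-sound (unit ℓ∈Γ ◅ ss) α⊨Γ =
  ⟶*-sound ss (propagate-sound (Any.singleton⁻ (All.lookup α⊨Γ ℓ∈Γ)) α⊨Γ)

UPRefutes-sound : ∀ {α Γ} → UPRefutes Γ → ¬ All (Sat α) Γ
UPRefutes-sound (_ , ss , _ , []∈Δ) α⊨Γ with () ← All.lookup (⟶*-sound ss α⊨Γ) []∈Δ

-- A total model of `Γ` falsifying `C` would satisfy `Γ ↾ (¬ᶜ C)`, and propagation would preserve it
-- down to a CNF containing the empty clause.
⊢₁-sound : ∀ {α Γ C} → Total α → Γ ⊢₁ C → All (Sat α) Γ → Sat α C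
⊢₁-sound α-total (inj₁ taut) α⊨Γ = Tautology⇒Sat α-total taut
⊢₁-sound {C = C} α-total (inj₂ refutes) α⊨Γ with sat? α-total C
... | yes α⊨C = α⊨C
... | no  α⊭C =
  contradiction (↾¬ᶜ⁺ {C = C} (¬Sat⇒⊇ˢ α-total α⊭C) α⊨Γ) (UPRefutes-sound refutes)

-- Derivations

resolution-sound : ∀ {α A B} x → Sat α (pos x ∷ A) → Sat α (neg x ∷ B) → Sat α (A ++ B)
resolution-sound x (there s) _ = Any.++⁺ˡ s
resolution-sound x (here t) (there s) = Any.++⁺ʳ _ s
resolution-sound {α} x (here t) (here t′) = contradiction t′ (True⇒¬True-~ α (pos x) t)

module _ {m : ℕ} (b : Fin m → Var) where

  -- Satisfaction is carried along with the bound because a cost-SR step may change the assignment,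
  -- after which every earlier clause has to be satisfied afresh.
  CheaperModel : Substitution → CNF → Set
  CheaperModel α Γ = ∃[ β ] Total β × All (Sat β) Γ × cost b β ≤ cost b α

  CostSR-sound : ∀ {α Γ D} → CostSR b Γ D → Total α → All (Sat α) Γ → CheaperModel α (D ∷ Γ)
  CostSR-sound {α} {Γ} {D} sr α-total α⊨Γ with sat? α-total D | sr
  ... | yes α⊨D | _         = α , α-total , α⊨D ∷ α⊨Γ , ℕ.≤-refl
  ... | no  α⊭D | inj₁ taut = contradiction (Tautology⇒Sat α-total taut) α⊭D
  ... | no  α⊭D | inj₂ (σ , Γ↾¬D⊢₁ , cheaper) =
    α ∘ˢ σ , Total-∘ˢ σ α-total , ↾⁻ α⊨↾σ , cheaper α α-total α⊇¬D
    where
    α⊇¬D : α ⊇ˢ ¬ᶜ D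
    α⊇¬D = ¬Sat⇒⊇ˢ α-total α⊭D

    α⊨↾σ : All (Sat α) ((D ∷ Γ) ↾ σ)
    α⊨↾σ = All.map (λ ⊢C → ⊢₁-sound α-total ⊢C (↾¬ᶜ⁺ {C = D} α⊇¬D α⊨Γ)) Γ↾¬D⊢₁

  Step-sound : ∀ {α Γ Ds D} → Step b Γ Ds D → Total α → All (Sat α) (Ds ++ Γ) →
               CheaperModel α (D ∷ Ds ++ Γ)
  Step-sound {α} {Γ} {Ds} {D} step α-total α⊨ = go step
    where
    unchanged : Sat α D → CheaperModel α (D ∷ Ds ++ Γ)
    unchanged α⊨D = α , α-total , α⊨D ∷ α⊨ , ℕ.≤-refl

    go : Step b Γ Ds D → CheaperModel α (D ∷ Ds ++ Γ)
    go (axiom D∈Γ)           = unchanged (Sat-∈ᶜ D∈Γ (All.++⁻ʳ Ds α⊨))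
    go (weaken A∈ A⊆D)       = unchanged (Any-resp-⊆ A⊆D (Sat-∈ᶜ A∈ α⊨))
    go (resolve x A∈ B∈ D≈)  = unchanged
      (Any-resp-⊆ (Equivalence.from D≈) (resolution-sound x (Sat-∈ᶜ A∈ α⊨) (Sat-∈ᶜ B∈ α⊨)))
    go (cost-sr sr _)        = CostSR-sound sr α-total α⊨

  Derivation-sound : ∀ {α Γ Ds} → Derivation b Γ Ds → Total α → All (Sat α) Γ →
                     CheaperModel α (Ds ++ Γ)
  Derivation-sound {α} ∅ α-total α⊨Γ = α , α-total , α⊨Γ , ℕ.≤-refl
  Derivation-sound (Ds ▷ step) α-total α⊨Γ =
    let β , β-total , β⊨ , β≤α = Derivation-sound Ds α-total α⊨Γ
        γ , γ-total , γ⊨ , γ≤β = Step-sound step β-total β⊨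
    in γ , γ-total , γ⊨ , ℕ.≤-trans γ≤β β≤α

-- Cost

-- `r` is the sum of `f` outside the image of `i`. By induction on `k`: the index `i zero` is
-- removed from `Fin (suc m)` and the remaining values of `i` are renumbered by `punchOut`.
sum-injection : ∀ {k m} (f : Fin m → ℕ) (i : Fin k → Fin m) → Injective _≡_ _≡_ i →
  ∃[ r ] sum f ≡ sum (f ∘ i) + r × ((∀ j → (∀ l → j ≢ i l) → f j ≡ 0) → r ≡ 0)
-- The image is empty, so the remainder is the whole sum.
sum-injection {zero} f i _ = sum f , refl , λ f≡0 → sum-zero f λ j → f≡0 j λ ()
  where
  sum-zero : ∀ {n} (g : Fin n → ℕ) → (∀ j → g j ≡ 0) → sum g ≡ 0
  sum-zero {zero}  g g≡0 = refl
  sum-zero {suc n} g g≡0 = cong₂ _+_ (g≡0 zero) (sum-zero (g ∘ suc) (g≡0 ∘ suc))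
sum-injection {suc k} {zero} f i _ with () ← i zero
sum-injection {suc k} {suc m} f i i-inj =
  let r , eq , r≡0 = sum-injection (f ∘ punchIn i₀) i′ i′-inj
  in r , split r eq , λ f≡0 → r≡0 λ j j∉i′ → f≡0 (punchIn i₀ j) (off-image j j∉i′)
  where
  open ≡-Reasoning

  i₀ : Fin (suc m)
  i₀ = i zero

  i₀≢ : ∀ l → i₀ ≢ i (suc l)
  i₀≢ l eq with () ← i-inj eq

  i′ : Fin k → Fin m
  i′ l = punchOut (i₀≢ l)

  i′-inj : Injective _≡_ _≡_ i′
  i′-inj eq = suc-injective (i-inj (punchOut-injective (i₀≢ _) (i₀≢ _) eq))

  -- Undoing the renumbering: an index missed by `i′` is sent by `punchIn i₀` to one missed by `i`,
  -- where `f` vanishes by assumption.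
  off-image : ∀ j → (∀ l → j ≢ i′ l) → ∀ l → punchIn i₀ j ≢ i l
  off-image j j∉i′ zero    eq = punchInᵢ≢i i₀ j eq
  off-image j j∉i′ (suc l) eq =
    j∉i′ l (punchIn-injective i₀ _ _ (trans eq (sym (punchIn-punchOut (i₀≢ l)))))

  split : ∀ r → sum (f ∘ punchIn i₀) ≡ sum (f ∘ punchIn i₀ ∘ i′) + r →
          sum f ≡ sum (f ∘ i) + r
  split r eq = begin
    sum f                                      ≡⟨ sum-remove f ⟩
    f i₀ + sum (f ∘ punchIn i₀)                ≡⟨ cong (f i₀ +_) eq ⟩
    f i₀ + (sum (f ∘ punchIn i₀ ∘ i′) + r)     ≡⟨ cong (λ s → f i₀ + (s + r))
                                                    (sum-cong-≗ (cong f ∘ punchIn-punchOut ∘ i₀≢)) ⟩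
    f i₀ + (sum (f ∘ i ∘ suc) + r)             ≡⟨ ℕ.+-assoc (f i₀) _ r ⟨
    sum (f ∘ i) + r                            ∎

sum-ones : ∀ {k} (f : Fin k → ℕ) → (∀ l → f l ≡ 1) → sum f ≡ k
sum-ones {zero}  f f≡1 = refl
sum-ones {suc k} f f≡1 = cong₂ _+_ (f≡1 zero) (sum-ones (f ∘ suc) (f≡1 ∘ suc))

-- A copy of the function local to cost, which is not in scope here.
bit : Value → ℕ
bit (const true)  = 1
bit (const false) = 0
bit (lit _)       = 0

-- Splitting on the head value at each stage of the induction makes the local function and its copy
-- both compute.
cost≡sum-bit : ∀ {m} (b : Fin m → Var) α → cost b α ≡ sum (bit ∘ α ∘ b)
cost≡sum-bit {zero}  b α = refl
cost≡sum-bit {suc m} b α with α (b zero)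
... | const true  = cong suc (cost≡sum-bit (b ∘ suc) α)
... | const false = cost≡sum-bit (b ∘ suc) α
... | lit _       = cost≡sum-bit (b ∘ suc) α

¬ᵛ-true⇒false : ∀ v → ¬ᵛ v ≡ const true → v ≡ const false
¬ᵛ-true⇒false (const false) _ = refl

module _ {k m : ℕ} (b : Fin m → Var) (i : Fin k → Fin m) (i-inj : Injective _≡_ _≡_ i)
         (α : Substitution) (ones : ∀ l → α (b (i l)) ≡ const true) where

  private
    split : ∃[ r ] sum (bit ∘ α ∘ b) ≡ sum (bit ∘ α ∘ b ∘ i) + r
                 × ((∀ j → (∀ l → j ≢ i l) → bit (α (b j)) ≡ 0) → r ≡ 0)
    split = sum-injection (bit ∘ α ∘ b) i i-inj

    -- The selected blocking variables contribute `k`. The lower bound discards the remainder; the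
    -- equality shows that it is zero.
    cost≡k+rest : cost b α ≡ k + proj₁ split
    cost≡k+rest = trans (cost≡sum-bit b α) (trans (proj₁ (proj₂ split))
      (cong (_+ proj₁ split) (sum-ones _ (cong bit ∘ ones))))

  k≤cost : k ≤ cost b α
  k≤cost = subst (k ≤_) (sym cost≡k+rest) (ℕ.m≤m+n k _)

  cost≡k : (∀ j → (∀ l → j ≢ i l) → α (b j) ≡ const false) → cost b α ≡ k
  cost≡k zeros = trans cost≡k+rest
    (trans (cong (k +_) (proj₂ (proj₂ split) λ j j∉i → cong bit (zeros j j∉i)))
           (ℕ.+-identityʳ k))

theorem4p2 : ∀ {m : ℕ} (M : MaxSAT m) →
    let open MaxSAT M in
    ∀ {Ds : CNF} → Derivation block cnf Ds →
    ∀ {k : ℕ} (i : Fin k → Fin m) → Injective _≡_ _≡_ i →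
    (∀ l → [ pos (block (i l)) ] ∈ᶜ Ds) →
    CostAtLeast block cnf k
    × ((∀ j → (∀ l → j ≢ i l) → [ neg (block j) ] ∈ᶜ Ds) →
    Satisfiable cnf → CostIs block cnf k)
theorem4p2 M {Ds} derivation {k} i i-inj b∈Ds = atLeast , exact
  where
  open MaxSAT M

  model : ∀ {α} → Total α → α ⊨ cnf → CheaperModel block α (Ds ++ cnf)
  model α-total α⊨ =
    Derivation-sound block derivation α-total (All.map (⊨ᶜ⇒Sat α-total) α⊨)

  ones : ∀ {β} → All (Sat β) (Ds ++ cnf) → ∀ l → β (block (i l)) ≡ const true
  ones β⊨ l = Any.singleton⁻ (Sat-∈ᶜ (b∈Ds l) (All.++⁻ˡ Ds β⊨))

  atLeast : CostAtLeast block cnf k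
  atLeast α α-total α⊨ =
    -- `α` itself may falsify the derived units, so the bound is read off `β` and carried back along
    -- `β≤α`.
    let β , _ , β⊨ , β≤α = model α-total α⊨
    in ℕ.≤-trans (k≤cost block i i-inj β (ones β⊨)) β≤α

  exact : (∀ j → (∀ l → j ≢ i l) → [ neg (block j) ] ∈ᶜ Ds) →
          Satisfiable cnf → CostIs block cnf k
  -- Soundness only moves an existing model, and satisfiability supplies one. Its image `β` attains
  -- the minimum, since the derived units fix the cost of `β` whatever that of `α`.
  exact ¬b∈Ds (α , α-total , α⊨) =
    let β , β-total , β⊨ , _ = model α-total α⊨
        zeros = λ j j∉i → ¬ᵛ-true⇒false (β (block j))
          (Any.singleton⁻ (Sat-∈ᶜ (¬b∈Ds j j∉i) (All.++⁻ˡ Ds β⊨)))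
    in ( β , β-total , All.map (Sat⇒⊨ᶜ β-total) (All.++⁻ʳ Ds β⊨)
       , cost≡k block i i-inj β (ones β⊨) zeros )
       , atLeast
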